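{- (RDR graph stitching) Let $X_1,X_2$ be two $d$-RDR graphs and let $f_1,f_2$ be their $d$-RDR coloring functions. Suppose that $e_1=\{u_1,v_1\}\in E(X_1)$ and $e_2=\{u_2,v_2\}\in E(X_2)$ are two edges with endpoints of same color: $f_1(u_1)=f_2(u_2)\ne\emptyset$ (implying $f_1(v_1)=f_2(v_2)=\emptyset$). Let $X_1*X_2$ be the graph with vertex set $V(X_1*X_2)=V(X_1)\cup V(X_2)$ and edge set $E(X_1*X_2)=(E(X_1)\cup E(X_2)\cup\{e_1',e_2'\})\setminus\{e_1,e_2\}$, where $e_1'=\{u_1,v_2\}$ and $e_2'=\{u_2,v_1\}$. Then $X_1*X_2$ is a $d$-RDR graph with $d$-RDR coloring function $f=f_1\cup f_2$. Moreover, a similar operation can be defined with several pairs of edges with endpoints of same color in each pair.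
   Context: All graphs are finite and simple, and $d$ is a positive integer. For a graph $G=(V,E)$, $N(v)$ is the open neighbourhood of $v$. Let $\mathcal K=\{1,\dots,k\}$. A $k$-rainbow dominating function ($k$-RDF) on $G$ is a map $f\colon V\to 2^{\mathcal K}$ such that $f(v)=\emptyset$ implies $\bigcup_{u\in N(v)}f(u)=\mathcal K$, for all $v\in V$. Its weight is $w(f)=\sum_{v\in V}|f(v)|$, and the $k$-rainbow domination number $\gamma_{rk}(G)$ is the minimum weight of a $k$-RDF on $G$. It is known that a $d$-regular graph $G$ of order $n$ satisfies $\gamma_{rd}(G)\ge n/2$. A $d$-regular graph $G$ of order $n$ is called $d$-rainbow domination regular ($d$-RDR) if $\gamma_{rd}(G)=n/2$. A $d$-RDR coloring function on a $d$-RDR graph is a $d$-RDF of minimum weight $n/2$. It is known that for such a function the sets of colored vertices ($f(v)\ne\emptyset$) and non-colored vertices ($f(v)=\emptyset$) form a bipartition of the graph into sets of size $n/2$, and each colored vertex receives exactly one color. The vertex sets of $X_1$ and $X_2$ are understood to be disjoint, and $f_1\cup f_2$ denotes the function on $V(X_1)\cup V(X_2)$ equal to $f_i$ on $V(X_i)$ for $i=1,2$. -}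

module Defs where

open import Data.Fin using (Fin)
open import Data.Fin.Properties using (any?)
open import Data.Fin.Subset using (Subset; ⊥; ⊤; ∣_∣; ⋃)
open import Data.List using (List; map; filter; length; _++_)
open import Data.List.Membership.Propositional using (_∈_)
open import Data.List.Membership.Propositional.Properties
  using (∈-map⁺; ∈-map⁻; ∈-++⁺ˡ; ∈-++⁺ʳ)
open import Data.List.Relation.Unary.Unique.Propositional using (Unique)
open import Data.List.Relation.Unary.Unique.Propositional.Properties
  using (map⁺; ++⁺)
open import Data.Nat using (ℕ; _*_; _≤_)
open import Data.Nat.ListAction using (sum)
open import Data.Product using (_×_; _,_; ∃; swap)
open import Data.Product.Properties using () renaming (≡-dec to ×-≡-dec)
open import Data.Sum using (_⊎_; inj₁; inj₂)
open import Data.Sum.Properties using (inj₁-injective; inj₂-injective)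
  renaming (≡-dec to ⊎-≡-dec)
open import Data.Sum.Relation.Binary.Pointwise as Pointwise
  using (Pointwise; ⊎-symmetric; ⊎-decidable)
open import Function using (const; _∘_)
open import Relation.Binary using (Decidable; DecidableEquality; Symmetric; Irreflexive)
open import Relation.Binary.PropositionalEquality using (_≡_; refl; cong)
open import Relation.Nullary using (¬_; Dec)
open import Relation.Nullary.Decidable using (_×-dec_; _⊎-dec_; ¬?)

-- A finite simple graph; `vertices` lists every vertex exactly once.
record Graph : Set₁ where
  field
    Vertex   : Set
    _≟ᵛ_     : DecidableEquality Vertex
    vertices : List Vertex
    unique   : Unique vertices
    complete : ∀ v → v ∈ vertices
    Adj      : Vertex → Vertex → Set
    adj?     : Decidable Adj
    adj-sym  : Symmetric Adj
    loopless : Irreflexive _≡_ Adj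

  order : ℕ
  order = length vertices

  N : Vertex → List Vertex
  N v = filter (adj? v) vertices

  degree : Vertex → ℕ
  degree v = length (N v)

open Graph public using (Vertex; Adj; order; N; degree)

Regular : ℕ → Graph → Set
Regular d G = ∀ v → degree G v ≡ d

-- Functions V → 2^{1,…,k}, with Fin k in the role of the colour set.
Colouring : ℕ → Graph → Set
Colouring k G = Vertex G → Subset k

IsRDF : (k : ℕ) (G : Graph) → Colouring k G → Set
IsRDF k G f = ∀ v → f v ≡ ⊥ → ⋃ (map f (N G v)) ≡ ⊤

weight : (k : ℕ) (G : Graph) → Colouring k G → ℕ
weight k G f = sum (map (λ v → ∣ f v ∣) (Graph.vertices G))

-- γ is the k-rainbow domination number of G, i.e. the minimum of the
-- weights of the k-rainbow dominating functions on G.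
IsRainbowDominationNumber : (k : ℕ) → Graph → ℕ → Set
IsRainbowDominationNumber k G γ =
  (∃ λ f → IsRDF k G f × weight k G f ≡ γ) ×
  (∀ f → IsRDF k G f → γ ≤ weight k G f)

-- γ = n/2 is written without division as 2γ = n.
IsRDR : ℕ → Graph → Set
IsRDR d G =
  Regular d G × (∃ λ γ → IsRainbowDominationNumber d G γ × 2 * γ ≡ order G)

-- On a d-RDR graph the weight n/2 is the minimum one.
IsRDRColouring : (d : ℕ) (G : Graph) → Colouring d G → Set
IsRDRColouring d G f = IsRDF d G f × 2 * weight d G f ≡ order G

infix 4 _≐_

-- A pair (a , b) stands for the unordered pair {a , b}.
_≐_ : {V : Set} → V × V → V × V → Set
e ≐ e′ = e ≡ e′ ⊎ e ≡ swap e′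

≐-dec : {V : Set} → DecidableEquality V → Decidable (_≐_ {V})
≐-dec _≟_ e e′ = ×-≡-dec _≟_ _≟_ e e′ ⊎-dec ×-≡-dec _≟_ _≟_ e (swap e′)

≐-swap : {V : Set} {e e′ : V × V} → e ≐ e′ → swap e ≐ e′
≐-swap (inj₁ eq) = inj₂ (cong swap eq)
≐-swap (inj₂ eq) = inj₁ (cong swap eq)

-- Stitching along m pairs of edges {u₁ i , v₁ i}, {u₂ i , v₂ i}: the edge set
-- is (E(X₁) ∪ E(X₂) ∪ New) ∖ Old. The pairs may share endpoints.
module Stitch (X₁ X₂ : Graph) {m : ℕ}
              (u₁ v₁ : Fin m → Vertex X₁) (u₂ v₂ : Fin m → Vertex X₂) where

  private
    module X₁ = Graph X₁
    module X₂ = Graph X₂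

  V : Set
  V = X₁.Vertex ⊎ X₂.Vertex

  Old : V × V → Set
  Old e = ∃ λ i → e ≐ (inj₁ (u₁ i) , inj₁ (v₁ i)) ⊎ e ≐ (inj₂ (u₂ i) , inj₂ (v₂ i))

  New : V × V → Set
  New e = ∃ λ i → e ≐ (inj₁ (u₁ i) , inj₂ (v₂ i)) ⊎ e ≐ (inj₂ (u₂ i) , inj₁ (v₁ i))

  -- Pointwise X₁.Adj X₂.Adj is E(X₁) ∪ E(X₂) on the disjoint union.
  StitchAdj : V → V → Set
  StitchAdj x y =
    (Pointwise X₁.Adj X₂.Adj x y ⊎ New (x , y)) × ¬ Old (x , y)

  _≟ⱽ_ : DecidableEquality V
  _≟ⱽ_ = ⊎-≡-dec X₁._≟ᵛ_ X₂._≟ᵛ_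

  old? : (e : V × V) → Dec (Old e)
  old? e = any? λ i → ≐-dec _≟ⱽ_ e _ ⊎-dec ≐-dec _≟ⱽ_ e _

  new? : (e : V × V) → Dec (New e)
  new? e = any? λ i → ≐-dec _≟ⱽ_ e _ ⊎-dec ≐-dec _≟ⱽ_ e _

  old-swap : ∀ {e} → Old e → Old (swap e)
  old-swap (i , inj₁ p) = i , inj₁ (≐-swap p)
  old-swap (i , inj₂ p) = i , inj₂ (≐-swap p)

  new-swap : ∀ {e} → New e → New (swap e)
  new-swap (i , inj₁ p) = i , inj₁ (≐-swap p)
  new-swap (i , inj₂ p) = i , inj₂ (≐-swap p)

  stitchAdj? : Decidable StitchAdj
  stitchAdj? x y =
    (⊎-decidable X₁.adj? X₂.adj? x y ⊎-dec new? (x , y))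
    ×-dec ¬? (old? (x , y))

  stitchAdj-sym : Symmetric StitchAdj
  stitchAdj-sym (inj₁ p , q) =
    inj₁ (⊎-symmetric X₁.adj-sym X₂.adj-sym p) , q ∘ old-swap
  stitchAdj-sym (inj₂ p , q) = inj₂ (new-swap p) , q ∘ old-swap

  stitchAdj-loopless : Irreflexive _≡_ StitchAdj
  stitchAdj-loopless refl (inj₁ (Pointwise.inj₁ a) , _) = X₁.loopless refl a
  stitchAdj-loopless refl (inj₁ (Pointwise.inj₂ a) , _) = X₂.loopless refl a
  stitchAdj-loopless refl (inj₂ (_ , inj₁ (inj₁ ())) , _)
  stitchAdj-loopless refl (inj₂ (_ , inj₁ (inj₂ ())) , _)
  stitchAdj-loopless refl (inj₂ (_ , inj₂ (inj₁ ())) , _)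
  stitchAdj-loopless refl (inj₂ (_ , inj₂ (inj₂ ())) , _)

  vertices-disjoint : {x : V} → ¬ (x ∈ map inj₁ X₁.vertices × x ∈ map inj₂ X₂.vertices)
  vertices-disjoint (p , q) with ∈-map⁻ inj₁ p | ∈-map⁻ inj₂ q
  ... | _ , _ , refl | _ , _ , ()

  vertices-complete : (x : V) → x ∈ map inj₁ X₁.vertices ++ map inj₂ X₂.vertices
  vertices-complete (inj₁ x) = ∈-++⁺ˡ (∈-map⁺ inj₁ (X₁.complete x))
  vertices-complete (inj₂ x) = ∈-++⁺ʳ _ (∈-map⁺ inj₂ (X₂.complete x))

  graph : Graph
  graph = record
    { Vertex   = V
    ; _≟ᵛ_     = _≟ⱽ_
    ; vertices = map inj₁ X₁.vertices ++ map inj₂ X₂.vertices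
    ; unique   = ++⁺ (map⁺ inj₁-injective X₁.unique) (map⁺ inj₂-injective X₂.unique)
                     vertices-disjoint
    ; complete = vertices-complete
    ; Adj      = StitchAdj
    ; adj?     = stitchAdj?
    ; adj-sym  = stitchAdj-sym
    ; loopless = stitchAdj-loopless
    }

stitchMany : (X₁ X₂ : Graph) {m : ℕ} →
             (u₁ v₁ : Fin m → Vertex X₁) (u₂ v₂ : Fin m → Vertex X₂) → Graph
stitchMany = Stitch.graph

-- X₁ * X₂ with respect to e₁ = {u₁ , v₁} and e₂ = {u₂ , v₂}.
stitch : (X₁ X₂ : Graph) → (u₁ v₁ : Vertex X₁) (u₂ v₂ : Vertex X₂) → Graph
stitch X₁ X₂ u₁ v₁ u₂ v₂ =
  stitchMany X₁ X₂ {1} (const u₁) (const v₁) (const u₂) (const v₂)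

{-# OPTIONS --safe #-}
-- Write s(v) for the sum of |f(u)| over the neighbours u of v.  For a d-RDF f on
-- a d-regular graph, d ≤ s(v) + d |f(v)| at every vertex v.  Summing over v gives
-- d n ≤ 2 d w(f), which is the bound n/2; and if 2 w(f) = n, then equality holds
-- at every vertex.  Hence neighbours of a coloured vertex are uncoloured, and
-- distinct neighbours of an uncoloured vertex have distinct colours.  Because of
-- the latter the switched edges at a vertex stay distinct after the switch, so
-- stitching replaces the neighbourhood of each vertex by one in bijection with
-- it, with the same colours: regularity and domination are preserved.
module Submission where

open import Defs
open import Data.Fin using (Fin; zero)
open import Data.Fin.Properties using (any?)
open import Data.Fin.Subset using (Subset; ⊥; ⊤; _∪_; ∣_∣; ⋃; inside; outside)
open import Data.Fin.Subset.Properties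
  using (∪-assoc; ∪-comm; ∪-idem; ∪-isCommutativeMonoid; ∣⊥∣≡0; ∣⊤∣≡n)
open import Data.List using (List; []; _∷_; map; filter; length; _++_)
open import Data.List.Membership.Propositional using (_∈_)
open import Data.List.Membership.Propositional.Properties
  using (∈-filter⁺; ∈-filter⁻; ∈-map⁺; ∈-map⁻)
open import Data.List.Membership.Propositional.Properties.WithK using (unique∧set⇒bag)
open import Data.List.Properties using (length-map; length-++; map-++; map-∘; map-cong; filter-≐)
open import Data.List.Relation.Binary.BagAndSetEquality using (∼bag⇒↭)
open import Data.List.Relation.Binary.Permutation.Propositional using (_↭_; ↭⇒↭ₛ)
open import Data.List.Relation.Binary.Permutation.Propositional.Properties
  using (↭-length) renaming (map⁺ to ↭-map⁺)
import Data.List.Relation.Binary.Permutation.Setoid.Properties as ↭ₛ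
open import Data.List.Relation.Unary.Any using (here; there)
open import Data.List.Relation.Unary.Unique.Propositional using (Unique)
open import Data.List.Relation.Unary.Unique.Propositional.Properties using (map⁺; filter⁺)
open import Data.Nat using (ℕ; _+_; _*_; _≤_; _<_; z≤n; s≤s; NonZero)
open import Data.Nat.ListAction using (sum)
open import Data.Nat.ListAction.Properties using (sum-++)
open import Data.Nat.Properties
open import Data.Nat.Tactic.RingSolver using (solve-∀)
open import Data.Product using (_×_; _,_; ∃; proj₂)
open import Data.Sum using (_⊎_; inj₁; inj₂; [_,_])
open import Data.Sum.Properties using (inj₁-injective; inj₂-injective)
open import Data.Sum.Relation.Binary.Pointwise using (inj₁; inj₂)
open import Data.Vec using ([]; _∷_)
open import Function using (_∘_; _⇔_; mk⇔; Equivalence)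
open import Function.Definitions using (Injective)
open import Relation.Binary using (Decidable)
open import Relation.Binary.PropositionalEquality
  using (_≡_; _≢_; refl; sym; trans; cong; cong₂; subst; setoid; module ≡-Reasoning)
open import Relation.Nullary using (¬_; Dec; yes; no; contradiction)
open import Relation.Nullary.Decidable using (_×-dec_; _⊎-dec_; map′)

private variable
  A B C : Set
  k d m : ℕ

-- Sums over lists and double counting.

sum-map-mono : {g h : A → ℕ} → (∀ x → g x ≤ h x) →
               ∀ xs → sum (map g xs) ≤ sum (map h xs)
sum-map-mono g≤h []       = z≤n
sum-map-mono g≤h (x ∷ xs) = +-mono-≤ (g≤h x) (sum-map-mono g≤h xs)

-- Slack in one term could not be recovered in the others, so comparable totals force termwise
-- equality. This is what turns an equality of sums over all vertices into an equality at each
-- vertex.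
sum-map-tight : {g h : A → ℕ} → (∀ x → g x ≤ h x) →
                ∀ {xs} → sum (map h xs) ≤ sum (map g xs) → ∀ {x} → x ∈ xs → h x ≤ g x
sum-map-tight {g = g} {h} g≤h {x ∷ xs} le (here refl) =
  +-cancelʳ-≤ (sum (map h xs)) (h x) (g x)
    (≤-trans le (+-monoʳ-≤ (g x) (sum-map-mono g≤h xs)))
sum-map-tight {g = g} {h} g≤h {x ∷ xs} le (there y∈xs) =
  sum-map-tight g≤h
    (+-cancelˡ-≤ (h x) _ _ (≤-trans le (+-monoˡ-≤ (sum (map g xs)) (g≤h x)))) y∈xs

sum-map-+ : ∀ (g h : A → ℕ) xs →
            sum (map (λ x → g x + h x) xs) ≡ sum (map g xs) + sum (map h xs)
sum-map-+ g h []       = refl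
sum-map-+ g h (x ∷ xs) rewrite sum-map-+ g h xs =
  interchange (g x) (h x) (sum (map g xs)) (sum (map h xs))
  where
  interchange : ∀ a b c e → a + b + (c + e) ≡ a + c + (b + e)
  interchange = solve-∀

sum-map-*ˡ : ∀ c (g : A → ℕ) xs → sum (map (λ x → c * g x) xs) ≡ c * sum (map g xs)
sum-map-*ˡ c g []       = sym (*-zeroʳ c)
sum-map-*ˡ c g (x ∷ xs) rewrite sum-map-*ˡ c g xs = sym (*-distribˡ-+ c (g x) _)

sum-map-const : ∀ c (xs : List A) → sum (map (λ _ → c) xs) ≡ c * length xs
sum-map-const c []       = sym (*-zeroʳ c)
sum-map-const c (x ∷ xs) rewrite sum-map-const c xs = sym (*-suc c (length xs))

∈⇒≤sum : ∀ (g : A → ℕ) {xs x} → x ∈ xs → g x ≤ sum (map g xs)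
∈⇒≤sum g {y ∷ ys} (here refl) = m≤m+n (g y) _
∈⇒≤sum g {y ∷ ys} (there x∈)  = ≤-trans (∈⇒≤sum g x∈) (m≤n+m _ (g y))

module _ {R : A → B → Set} (R? : Decidable R) (a : B → ℕ) where

  private
    row : List B → A → ℕ
    row ys x = sum (map a (filter (R? x) ys))

    column : List A → B → ℕ
    column xs y = length (filter (λ x → R? x y) xs) * a y

    first-column : ∀ xs y ys → sum (map (row (y ∷ ys)) xs) ≡ column xs y + sum (map (row ys) xs)
    first-column []       y ys = refl
    first-column (x ∷ xs) y ys with R? x y
    ... | yes _ rewrite first-column xs y ys =
      shuffle (a y) (row ys x) (column xs y) (sum (map (row ys) xs))
      where
      shuffle : ∀ p q r s → p + q + (r + s) ≡ p + r + (q + s)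
      shuffle = solve-∀
    ... | no  _ rewrite first-column xs y ys =
      shuffle (row ys x) (column xs y) (sum (map (row ys) xs))
      where
      shuffle : ∀ q r s → q + (r + s) ≡ r + (q + s)
      shuffle = solve-∀

  -- Both sides add `a y` over all pairs with `R x y`, grouped by `x` on the left and by `y` on the
  -- right. The induction splits off one column at a time.
  double-count : ∀ xs ys → sum (map (row ys) xs) ≡ sum (map (column xs) ys)
  double-count xs []       = sum-map-const 0 xs
  double-count xs (y ∷ ys) =
    trans (first-column xs y ys) (cong (column xs y +_) (double-count xs ys))

-- Cardinalities of unions of colour sets.

≢⊥⇒∣∣>0 : ∀ {p : Subset k} → p ≢ ⊥ → 0 < ∣ p ∣
≢⊥⇒∣∣>0 {p = []}          p≢⊥ = contradiction refl p≢⊥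
≢⊥⇒∣∣>0 {p = inside  ∷ p} p≢⊥ = s≤s z≤n
≢⊥⇒∣∣>0 {p = outside ∷ p} p≢⊥ = ≢⊥⇒∣∣>0 (p≢⊥ ∘ cong (outside ∷_))

⊥? : (p : Subset k) → Dec (p ≡ ⊥)
⊥? []            = yes refl
⊥? (inside  ∷ p) = no λ ()
⊥? (outside ∷ p) = map′ (cong (outside ∷_)) (λ { refl → refl }) (⊥? p)

∣p∪q∣≤∣p∣+∣q∣ : ∀ (p q : Subset k) → ∣ p ∪ q ∣ ≤ ∣ p ∣ + ∣ q ∣
∣p∪q∣≤∣p∣+∣q∣ []            []            = z≤n
∣p∪q∣≤∣p∣+∣q∣ (outside ∷ p) (outside ∷ q) = ∣p∪q∣≤∣p∣+∣q∣ p q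
∣p∪q∣≤∣p∣+∣q∣ (outside ∷ p) (inside  ∷ q) =
  ≤-trans (s≤s (∣p∪q∣≤∣p∣+∣q∣ p q)) (≤-reflexive (sym (+-suc ∣ p ∣ ∣ q ∣)))
∣p∪q∣≤∣p∣+∣q∣ (inside  ∷ p) (outside ∷ q) = s≤s (∣p∪q∣≤∣p∣+∣q∣ p q)
∣p∪q∣≤∣p∣+∣q∣ (inside  ∷ p) (inside  ∷ q) =
  s≤s (≤-trans (∣p∪q∣≤∣p∣+∣q∣ p q) (+-monoʳ-≤ ∣ p ∣ (n≤1+n ∣ q ∣)))

∣⋃∣≤sum : ∀ (f : A → Subset k) xs → ∣ ⋃ (map f xs) ∣ ≤ sum (map (∣_∣ ∘ f) xs)
∣⋃∣≤sum {k = k} f []       = ≤-reflexive (∣⊥∣≡0 k)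
∣⋃∣≤sum         f (x ∷ xs) =
  ≤-trans (∣p∪q∣≤∣p∣+∣q∣ (f x) _) (+-monoʳ-≤ ∣ f x ∣ (∣⋃∣≤sum f xs))

⋃-absorbs : ∀ (f : A → Subset k) {xs x} → x ∈ xs → f x ∪ ⋃ (map f xs) ≡ ⋃ (map f xs)
⋃-absorbs f {y ∷ ys} (here refl) =
  trans (sym (∪-assoc (f y) (f y) U)) (cong (_∪ U) (∪-idem (f y)))
  where U = ⋃ (map f ys)
⋃-absorbs f {y ∷ ys} {x} (there x∈ys) = begin
  f x ∪ (f y ∪ U)  ≡⟨ ∪-assoc (f x) (f y) U ⟨
  (f x ∪ f y) ∪ U  ≡⟨ cong (_∪ U) (∪-comm (f x) (f y)) ⟩
  (f y ∪ f x) ∪ U  ≡⟨ ∪-assoc (f y) (f x) U ⟩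
  f y ∪ (f x ∪ U)  ≡⟨ cong (f y ∪_) (⋃-absorbs f x∈ys) ⟩
  f y ∪ U          ∎
  where
  open ≡-Reasoning
  U = ⋃ (map f ys)

-- A repeated colour set is absorbed by its other copy in the union but is counted twice in the sum,
-- so the union bound has at least that much slack.
∣⋃∣-overlap : ∀ (f : A → Subset k) {xs x y} → x ∈ xs → y ∈ xs → x ≢ y → f x ≡ f y →
              ∣ f x ∣ + ∣ ⋃ (map f xs) ∣ ≤ sum (map (∣_∣ ∘ f) xs)
∣⋃∣-overlap f (here refl) (here refl) x≢y eq = contradiction refl x≢y
∣⋃∣-overlap f {x ∷ xs} (here refl) (there y∈) x≢y eq
  rewrite eq | ⋃-absorbs f y∈ = +-monoʳ-≤ _ (∣⋃∣≤sum f xs)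
∣⋃∣-overlap f {y ∷ xs} (there x∈) (here refl) x≢y eq
  rewrite sym eq | ⋃-absorbs f x∈ = +-monoʳ-≤ _ (∣⋃∣≤sum f xs)
∣⋃∣-overlap f {z ∷ zs} {x} (there x∈) (there y∈) x≢y eq = begin
  ∣ f x ∣ + ∣ f z ∪ U ∣               ≤⟨ +-monoʳ-≤ ∣ f x ∣ (∣p∪q∣≤∣p∣+∣q∣ (f z) U) ⟩
  ∣ f x ∣ + (∣ f z ∣ + ∣ U ∣)         ≡⟨ swap-first (∣ f x ∣) (∣ f z ∣) (∣ U ∣) ⟩
  ∣ f z ∣ + (∣ f x ∣ + ∣ U ∣)         ≤⟨ +-monoʳ-≤ ∣ f z ∣ (∣⋃∣-overlap f x∈ y∈ x≢y eq) ⟩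
  ∣ f z ∣ + sum (map (∣_∣ ∘ f) zs)    ∎
  where
  open ≤-Reasoning
  U = ⋃ (map f zs)
  swap-first : ∀ a b c → a + (b + c) ≡ b + (a + c)
  swap-first = solve-∀

⋃-↭ : {ps qs : List (Subset k)} → ps ↭ qs → ⋃ ps ≡ ⋃ qs
⋃-↭ {k} = ↭ₛ.foldr-commMonoid (setoid _) (∪-isCommutativeMonoid k) ∘ ↭⇒↭ₛ

-- Neighbourhoods and sums over them.

module _ (G : Graph) where
  open Graph G using (vertices; unique; complete; adj?; adj-sym)

  ∈N⇒Adj : ∀ {v w} → w ∈ N G v → Adj G v w
  ∈N⇒Adj {v} = proj₂ ∘ ∈-filter⁻ (adj? v) {xs = vertices}

  Adj⇒∈N : ∀ {v w} → Adj G v w → w ∈ N G v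
  Adj⇒∈N {v} {w} = ∈-filter⁺ (adj? v) (complete w)

  N-unique : ∀ v → Unique (N G v)
  N-unique v = filter⁺ (adj? v) unique

  -- Exchanging the order of summation collects `a u` once from every neighbour of `u`, hence `d`
  -- times.
  sum-over-neighbours : Regular d G → ∀ (a : Vertex G → ℕ) →
    sum (map (λ v → sum (map a (N G v))) vertices) ≡ d * sum (map a vertices)
  sum-over-neighbours {d} reg a = begin
    sum (map (λ v → sum (map a (N G v))) vertices)
      ≡⟨ double-count adj? a vertices vertices ⟩
    sum (map (λ u → length (filter (λ v → adj? v u) vertices) * a u) vertices)
      ≡⟨ cong sum (map-cong (λ u → cong (_* a u) (in-degree u)) vertices) ⟩
    sum (map (λ u → d * a u) vertices)
      ≡⟨ sum-map-*ˡ d a vertices ⟩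
    d * sum (map a vertices) ∎
    where
    open ≡-Reasoning
    in-degree : ∀ u → length (filter (λ v → adj? v u) vertices) ≡ d
    -- The column of `u` filters by `Adj v u` in the variable `v`; symmetry identifies it with
    -- `N G u`.
    in-degree u = trans
      (cong length (filter-≐ (λ v → adj? v u) (adj? u) (adj-sym , adj-sym) vertices))
      (reg u)

-- The lower bound on the weight and its equality case.

module RegularRDF (G : Graph) {d} .{{_ : NonZero d}} (reg : Regular d G)
                  {f : Colouring d G} (rdf : IsRDF d G f) where
  open Graph G using (vertices; complete; adj-sym; _≟ᵛ_)

  neighbourWeight : Vertex G → ℕ
  neighbourWeight v = sum (map (∣_∣ ∘ f) (N G v))

  load : Vertex G → ℕ
  load v = neighbourWeight v + d * ∣ f v ∣

  -- An uncoloured vertex sees all `d` colours in its neighbourhood; a coloured one reaches `d` by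
  -- the second summand alone, since its colour set has at least one element.
  d≤load : ∀ v → d ≤ load v
  d≤load v with ⊥? (f v)
  ... | yes fv≡⊥ = begin
    d                      ≡⟨ ∣⊤∣≡n d ⟨
    ∣ ⊤ {d} ∣              ≡⟨ cong ∣_∣ (rdf v fv≡⊥) ⟨
    ∣ ⋃ (map f (N G v)) ∣  ≤⟨ ∣⋃∣≤sum f (N G v) ⟩
    neighbourWeight v      ≤⟨ m≤m+n _ _ ⟩
    load v                 ∎
    where open ≤-Reasoning
  ... | no fv≢⊥ = begin
    d              ≡⟨ *-identityʳ d ⟨
    d * 1          ≤⟨ *-monoʳ-≤ d (≢⊥⇒∣∣>0 fv≢⊥) ⟩
    d * ∣ f v ∣    ≤⟨ m≤n+m _ (neighbourWeight v) ⟩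
    load v         ∎
    where open ≤-Reasoning

  total-load : sum (map load vertices) ≡ d * (2 * weight d G f)
  total-load = begin
    sum (map load vertices)
      ≡⟨ sum-map-+ neighbourWeight _ vertices ⟩
    sum (map neighbourWeight vertices) + sum (map (λ v → d * ∣ f v ∣) vertices)
      ≡⟨ cong₂ _+_ (sum-over-neighbours G reg (∣_∣ ∘ f)) (sum-map-*ˡ d (∣_∣ ∘ f) vertices) ⟩
    d * weight d G f + d * weight d G f
      ≡⟨ double d (weight d G f) ⟩
    d * (2 * weight d G f) ∎
    where
    open ≡-Reasoning
    double : ∀ a b → a * b + a * b ≡ a * (2 * b)
    double = solve-∀

  order≤2*weight : order G ≤ 2 * weight d G f
  -- Summation leaves a factor `d` on both sides, which cancels because `d` is nonzero.
  order≤2*weight = *-cancelˡ-≤ d (begin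
    d * order G                    ≡⟨ sum-map-const d vertices ⟨
    sum (map (λ _ → d) vertices)   ≤⟨ sum-map-mono d≤load vertices ⟩
    sum (map load vertices)        ≡⟨ total-load ⟩
    d * (2 * weight d G f)         ∎)
    where open ≤-Reasoning

  module Minimum (min : 2 * weight d G f ≡ order G) where

    -- When `min` holds, `load` and the constant `d` have the same total, so `d≤load` is tight at
    -- every vertex.
    load≤d : ∀ v → load v ≤ d
    load≤d v = sum-map-tight d≤load
      (≤-reflexive (trans total-load (trans (cong (d *_) min) (sym (sum-map-const d vertices)))))
      (complete v)

    -- The colours of `u` itself already account for a load of `d`; a coloured neighbour would push
    -- the load of `u` above it.
    coloured⇒neighbour-uncoloured : ∀ {u v} → f u ≢ ⊥ → Adj G u v → f v ≡ ⊥
    coloured⇒neighbour-uncoloured {u} {v} fu≢⊥ u~v with ⊥? (f v)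
    ... | yes fv≡⊥ = fv≡⊥
    ... | no  fv≢⊥ = contradiction (load≤d u) (<⇒≱ (begin-strict
      d                              <⟨ +-monoˡ-≤ d (≢⊥⇒∣∣>0 fv≢⊥) ⟩
      ∣ f v ∣ + d                    ≤⟨ +-mono-≤ (∈⇒≤sum (∣_∣ ∘ f) (Adj⇒∈N G u~v))
                                                 (≤-trans (≤-reflexive (sym (*-identityʳ d)))
                                                          (*-monoʳ-≤ d (≢⊥⇒∣∣>0 fu≢⊥))) ⟩
      load u                         ∎))
      where open ≤-Reasoning

    -- The neighbours of `v` must cover all `d` colours with total weight at most `d`. A nonempty
    -- colour set occurring at two different neighbours would be wasted weight.
    uncoloured⇒same-colour⇒≡ : ∀ {v x y} → f v ≡ ⊥ → f x ≢ ⊥ → Adj G v x → Adj G v y →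
                               f x ≡ f y → x ≡ y
    uncoloured⇒same-colour⇒≡ {v} {x} {y} fv≡⊥ fx≢⊥ v~x v~y fx≡fy with x ≟ᵛ y
    ... | yes x≡y = x≡y
    ... | no  x≢y = contradiction (load≤d v) (<⇒≱ (begin-strict
      d                                ≡⟨ trans (cong ∣_∣ (rdf v fv≡⊥)) (∣⊤∣≡n d) ⟨
      ∣ ⋃ (map f (N G v)) ∣            <⟨ +-monoˡ-≤ _ (≢⊥⇒∣∣>0 fx≢⊥) ⟩
      ∣ f x ∣ + ∣ ⋃ (map f (N G v)) ∣  ≤⟨ ∣⋃∣-overlap f (Adj⇒∈N G v~x) (Adj⇒∈N G v~y) x≢y fx≡fy ⟩
      neighbourWeight v                ≤⟨ m≤m+n _ _ ⟩
      load v                           ∎))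
      where open ≤-Reasoning

-- The colouring itself attains the minimum: twice its weight is the order, which is at most twice
-- the weight of any competitor.
RDRColouring⇒RDR : .{{_ : NonZero d}} (G : Graph) → Regular d G →
                   {f : Colouring d G} → IsRDRColouring d G f → IsRDR d G
RDRColouring⇒RDR {d} G reg {f} (rdf , min) =
  reg , weight d G f , ((f , rdf , refl) , minimal) , min
  where
  minimal : ∀ g → IsRDF d G g → weight d G f ≤ weight d G g
  minimal g g-rdf = *-cancelˡ-≤ 2
    (≤-trans (≤-reflexive min) (RegularRDF.order≤2*weight G reg g-rdf))

-- Exchanging entries of a list without repetitions.

-- Some entries near j of a list are exchanged for far j; I j says that the
-- index j takes part in the exchange.
module Exchange {A B V J : Set}
  {ιA : A → V} {ιB : B → V} (ιA-injective : Injective _≡_ _≡_ ιA)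
  (ιB-injective : Injective _≡_ _≡_ ιB) (ι-disjoint : ∀ {a b} → ιA a ≢ ιB b)
  {xs : List A} (xs-unique : Unique xs) {I : J → Set} {near : J → A} {far : J → B}
  (near∈xs : ∀ {j} → I j → near j ∈ xs)
  (near-injective : ∀ {i j} → I i → I j → near i ≡ near j → i ≡ j)
  (far-injective : ∀ {i j} → I i → I j → far i ≡ far j → i ≡ j)
  (moved? : ∀ a → Dec (∃ λ j → I j × near j ≡ a)) where

  exchange : A → V
  exchange a with moved? a
  ... | yes (j , _) = ιB (far j)
  ... | no  _       = ιA a

  -- The members of `map exchange xs`, described without `exchange` and in the shape of `StitchAdj`:
  -- surviving old neighbours and new ones.
  data Exchanged : V → Set where
    kept     : ∀ {a} → a ∈ xs → ¬ (∃ λ j → I j × near j ≡ a) → Exchanged (ιA a)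
    replaced : ∀ {j} → I j → Exchanged (ιB (far j))

  -- A kept and a replaced entry cannot collide, as the two embeddings have disjoint images; two
  -- replaced entries are separated by `far-injective`.
  exchange-injective : Injective _≡_ _≡_ exchange
  exchange-injective {a} {b} eq with moved? a | moved? b
  ... | yes (i , Ii , refl) | yes (j , Ij , refl) =
    cong near (far-injective Ii Ij (ιB-injective eq))
  ... | yes _ | no  _ = contradiction (sym eq) ι-disjoint
  ... | no  _ | yes _ = contradiction eq ι-disjoint
  ... | no  _ | no  _ = ιA-injective eq

  exchange-exchanged : ∀ {a} → a ∈ xs → Exchanged (exchange a)
  exchange-exchanged {a} a∈xs with moved? a
  ... | yes (j , Ij , _) = replaced Ij
  ... | no  ¬moved       = kept a∈xs ¬moved

  exchange-kept : ∀ {a} → ¬ (∃ λ j → I j × near j ≡ a) → exchange a ≡ ιA a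
  exchange-kept {a} ¬moved with moved? a
  ... | yes moved = contradiction moved ¬moved
  ... | no  _     = refl

  exchange-near : ∀ {j} → I j → exchange (near j) ≡ ιB (far j)
  exchange-near {j} Ij with moved? (near j)
  -- The search may return an index `i` other than `j`; `near-injective` shows that they agree.
  ... | yes (i , Ii , eq) = cong (ιB ∘ far) (near-injective Ii Ij eq)
  ... | no  ¬moved        = contradiction (j , Ij , refl) ¬moved

  exchanged⇒∈ : ∀ {y} → Exchanged y → y ∈ map exchange xs
  exchanged⇒∈ (kept a∈xs ¬moved) =
    subst (_∈ map exchange xs) (exchange-kept ¬moved) (∈-map⁺ exchange a∈xs)
  exchanged⇒∈ (replaced Ij) =
    subst (_∈ map exchange xs) (exchange-near Ij) (∈-map⁺ exchange (near∈xs Ij))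

  -- Lists without repetitions that have the same members are equal as bags, so the order in which
  -- the neighbours are listed never has to be tracked.
  exchange-↭ : ∀ {ys} → Unique ys → (∀ {y} → y ∈ ys ⇔ Exchanged y) → ys ↭ map exchange xs
  exchange-↭ {ys} ys-unique ∈ys⇔ = ∼bag⇒↭
    (unique∧set⇒bag ys-unique (map⁺ exchange-injective xs-unique)
      (mk⇔ (exchanged⇒∈ ∘ Equivalence.to ∈ys⇔) from))
    where
    from : ∀ {y} → y ∈ map exchange xs → y ∈ ys
    from y∈ with ∈-map⁻ exchange y∈
    ... | a , a∈xs , refl = Equivalence.from ∈ys⇔ (exchange-exchanged a∈xs)

  exchange-map : (g : V → C) → (∀ {j} → I j → g (ιB (far j)) ≡ g (ιA (near j))) →
                 map g (map exchange xs) ≡ map (g ∘ ιA) xs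
  exchange-map g g-far≡g-near = trans (sym (map-∘ xs)) (map-cong g-exchange xs)
    where
    g-exchange : ∀ a → g (exchange a) ≡ g (ιA a)
    g-exchange a with moved? a
    ... | yes (j , Ij , refl) = g-far≡g-near Ij
    ... | no  _               = refl

any-⊎? : {P : Fin m ⊎ Fin m → Set} → (∀ j → Dec (P j)) → Dec (∃ P)
any-⊎? P? = map′
  [ (λ (i , p) → inj₁ i , p) , (λ (i , p) → inj₂ i , p) ]
  (λ { (inj₁ i , p) → inj₁ (i , p) ; (inj₂ i , p) → inj₂ (i , p) })
  (any? (P? ∘ inj₁) ⊎-dec any? (P? ∘ inj₂))

-- Switched half-edges in one half of the stitched graph.

-- The stitching seen from one half: unprimed data live there, primed data on
-- the other half.
record StitchingData (d : ℕ) {G H : Graph} (f : Colouring d G) (g : Colouring d H)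
                     (u v : Fin m → Vertex G) (u′ v′ : Fin m → Vertex H) : Set where
  field
    edge       : ∀ i → Adj G (u i) (v i)
    u-coloured : ∀ i → f (u i) ≢ ⊥
    v-blank    : ∀ i → f (v i) ≡ ⊥
    v′-blank   : ∀ i → g (v′ i) ≡ ⊥
    colours    : ∀ i → f (u i) ≡ g (u′ i)
    injective  : Injective _≡_ _≐_ (λ i → u i , v i)
    u-v′       : ∀ {i j} → u i ≡ u j → v′ i ≡ v′ j → i ≡ j
    v-u′       : ∀ {i j} → v i ≡ v j → u′ i ≡ u′ j → i ≡ j

-- The half-edges of G to be switched are indexed by Fin m ⊎ Fin m: inj₁ i is
-- based at u i and inj₂ i at v i.
module HalfEdges {d} {G H : Graph} {f : Colouring d G} {g : Colouring d H}
                 {u v : Fin m → Vertex G} {u′ v′ : Fin m → Vertex H}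
                 (S : StitchingData d {G} {H} f g u v u′ v′) where
  open StitchingData S
  open Graph G using (_≟ᵛ_; adj-sym)

  base near : Fin m ⊎ Fin m → Vertex G
  base = [ u , v ]
  near = [ v , u ]

  far : Fin m ⊎ Fin m → Vertex H
  far = [ v′ , u′ ]

  near-adjacent : ∀ {x} j → base j ≡ x → Adj G x (near j)
  near-adjacent (inj₁ i) refl = edge i
  near-adjacent (inj₂ i) refl = adj-sym (edge i)

  u≢v : ∀ {i j} → u i ≢ v j
  u≢v {i} {j} eq = u-coloured i (trans (cong f eq) (v-blank j))

  -- Two half-edges with a common base are of the same kind, because every `u i` is coloured and
  -- every `v j` is not. Distinctness of the switched edges then decides.
  near-injective : ∀ {x} i j → base i ≡ x → base j ≡ x → near i ≡ near j → i ≡ j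
  near-injective (inj₁ i) (inj₁ j) p q r = cong inj₁ (injective (inj₁ (cong₂ _,_ (trans p (sym q)) r)))
  near-injective (inj₁ i) (inj₂ j) p q r = contradiction (trans p (sym q)) u≢v
  near-injective (inj₂ i) (inj₁ j) p q r = contradiction (trans q (sym p)) u≢v
  near-injective (inj₂ i) (inj₂ j) p q r = cong inj₂ (injective (inj₁ (cong₂ _,_ r (trans p (sym q)))))

  -- This prevents two new edges at one vertex from merging, which would lower its degree. It rests
  -- on the crossing conditions `u-v′` and `v-u′`.
  far-injective : ∀ {x} i j → base i ≡ x → base j ≡ x → far i ≡ far j → i ≡ j
  far-injective (inj₁ i) (inj₁ j) p q r = cong inj₁ (u-v′ (trans p (sym q)) r)
  far-injective (inj₁ i) (inj₂ j) p q r = contradiction (trans p (sym q)) u≢v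
  far-injective (inj₂ i) (inj₁ j) p q r = contradiction (trans q (sym p)) u≢v
  far-injective (inj₂ i) (inj₂ j) p q r = cong inj₂ (v-u′ (trans p (sym q)) r)

  same-colour : ∀ j → g (far j) ≡ f (near j)
  same-colour (inj₁ i) = trans (v′-blank i) (sym (v-blank i))
  same-colour (inj₂ i) = sym (colours i)

  -- The embeddings stay abstract so that one argument serves both halves, with `inj₁` and `inj₂`
  -- interchanged.
  module _ {V : Set} {ιG : Vertex G → V} {ιH : Vertex H → V}
           (ιG-injective : Injective _≡_ _≡_ ιG) (ιH-injective : Injective _≡_ _≡_ ιH)
           (ι-disjoint : ∀ {a b} → ιG a ≢ ιH b) (x : Vertex G) where

    private
      module E = Exchange ιG-injective ιH-injective ι-disjoint (N-unique G x)
        {I = λ j → base j ≡ x} {near} {far}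
        (λ {j} p → Adj⇒∈N G (near-adjacent j p))
        (λ {i} {j} → near-injective i j) (λ {i} {j} → far-injective i j)
        (λ a → any-⊎? λ j → (base j ≟ᵛ x) ×-dec (near j ≟ᵛ a))

    open E public using (Exchanged; kept; replaced)

    exchanged-length : ∀ {ys} → Unique ys → (∀ {y} → y ∈ ys ⇔ Exchanged y) →
                       length ys ≡ degree G x
    exchanged-length ys-unique ∈ys⇔ =
      trans (↭-length (E.exchange-↭ ys-unique ∈ys⇔)) (length-map E.exchange (N G x))

    -- Each new neighbour has the colour set of the one it replaces, so the colour sets around `x`
    -- change at most in order, which a union ignores.
    exchanged-⋃ : ∀ {ys} (h : V → Subset d) → (∀ a → h (ιG a) ≡ f a) → (∀ b → h (ιH b) ≡ g b) →
                  Unique ys → (∀ {y} → y ∈ ys ⇔ Exchanged y) →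
                  ⋃ (map h ys) ≡ ⋃ (map f (N G x))
    exchanged-⋃ h h-G h-H ys-unique ∈ys⇔ = trans
      (⋃-↭ (↭-map⁺ h (E.exchange-↭ ys-unique ∈ys⇔)))
      (cong ⋃ (trans (E.exchange-map h λ {j} _ → trans (h-H _) (trans (same-colour j) (sym (h-G _))))
                     (map-cong h-G (N G x))))

-- Neighbourhoods, regularity and domination in the stitched graph.

module StitchRDR {d} .{{_ : NonZero d}} {X₁ X₂ : Graph} {f₁ : Colouring d X₁} {f₂ : Colouring d X₂}
                 {u₁ v₁ : Fin m → Vertex X₁} {u₂ v₂ : Fin m → Vertex X₂}
                 (S₁ : StitchingData d {X₁} {X₂} f₁ f₂ u₁ v₁ u₂ v₂)
                 (S₂ : StitchingData d {X₂} {X₁} f₂ f₁ u₂ v₂ u₁ v₁) where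
  open Stitch X₁ X₂ u₁ v₁ u₂ v₂ using (V; Old; New; StitchAdj; graph)
  private
    module H₁ = HalfEdges S₁
    module H₂ = HalfEdges S₂

    f : Colouring d graph
    f = [ f₁ , f₂ ]

    Exchanged₁ : Vertex X₁ → V → Set
    Exchanged₁ = H₁.Exchanged inj₁-injective inj₂-injective λ ()

    Exchanged₂ : Vertex X₂ → V → Set
    Exchanged₂ = H₂.Exchanged inj₂-injective inj₁-injective λ ()

  -- This and the following lemmas translate the unordered pairs of `Old` and `New` into half-edges
  -- based at the first endpoint. The absurd cases would put that endpoint in the other half.
  old₁⁻ : ∀ {x y} → Old (inj₁ x , y) → ∃ λ j → H₁.base j ≡ x × inj₁ (H₁.near j) ≡ y
  old₁⁻ (i , inj₁ (inj₁ refl)) = inj₁ i , refl , refl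
  old₁⁻ (i , inj₁ (inj₂ refl)) = inj₂ i , refl , refl
  old₁⁻ (i , inj₂ (inj₁ ()))
  old₁⁻ (i , inj₂ (inj₂ ()))

  old₁⁺ : ∀ j → Old (inj₁ (H₁.base j) , inj₁ (H₁.near j))
  old₁⁺ (inj₁ i) = i , inj₁ (inj₁ refl)
  old₁⁺ (inj₂ i) = i , inj₁ (inj₂ refl)

  new₁⁻ : ∀ {x y} → New (inj₁ x , y) → ∃ λ j → H₁.base j ≡ x × inj₂ (H₁.far j) ≡ y
  new₁⁻ (i , inj₁ (inj₁ refl)) = inj₁ i , refl , refl
  new₁⁻ (i , inj₂ (inj₂ refl)) = inj₂ i , refl , refl
  new₁⁻ (i , inj₁ (inj₂ ()))
  new₁⁻ (i , inj₂ (inj₁ ()))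

  new₁⁺ : ∀ j → New (inj₁ (H₁.base j) , inj₂ (H₁.far j))
  new₁⁺ (inj₁ i) = i , inj₁ (inj₁ refl)
  new₁⁺ (inj₂ i) = i , inj₂ (inj₂ refl)

  old₂⁻ : ∀ {x y} → Old (inj₂ x , y) → ∃ λ j → H₂.base j ≡ x × inj₂ (H₂.near j) ≡ y
  old₂⁻ (i , inj₂ (inj₁ refl)) = inj₁ i , refl , refl
  old₂⁻ (i , inj₂ (inj₂ refl)) = inj₂ i , refl , refl
  old₂⁻ (i , inj₁ (inj₁ ()))
  old₂⁻ (i , inj₁ (inj₂ ()))

  old₂⁺ : ∀ j → Old (inj₂ (H₂.base j) , inj₂ (H₂.near j))
  old₂⁺ (inj₁ i) = i , inj₂ (inj₁ refl)
  old₂⁺ (inj₂ i) = i , inj₂ (inj₂ refl)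

  new₂⁻ : ∀ {x y} → New (inj₂ x , y) → ∃ λ j → H₂.base j ≡ x × inj₁ (H₂.far j) ≡ y
  new₂⁻ (i , inj₂ (inj₁ refl)) = inj₁ i , refl , refl
  new₂⁻ (i , inj₁ (inj₂ refl)) = inj₂ i , refl , refl
  new₂⁻ (i , inj₂ (inj₂ ()))
  new₂⁻ (i , inj₁ (inj₁ ()))

  new₂⁺ : ∀ j → New (inj₂ (H₂.base j) , inj₁ (H₂.far j))
  new₂⁺ (inj₁ i) = i , inj₂ (inj₁ refl)
  new₂⁺ (inj₂ i) = i , inj₁ (inj₂ refl)

  adj₁⇒exchanged : ∀ {x y} → StitchAdj (inj₁ x) y → Exchanged₁ x y
  adj₁⇒exchanged (inj₁ (inj₁ x~a) , ¬old) =
    H₁.kept (Adj⇒∈N X₁ x~a) λ { (j , refl , refl) → ¬old (old₁⁺ j) }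
  adj₁⇒exchanged (inj₂ new , _) with new₁⁻ new
  ... | j , base≡x , refl = H₁.replaced {j = j} base≡x

  exchanged⇒adj₁ : ∀ {x y} → Exchanged₁ x y → StitchAdj (inj₁ x) y
  exchanged⇒adj₁ (H₁.kept a∈N ¬moved) = inj₁ (inj₁ (∈N⇒Adj X₁ a∈N)) ,
    λ old → let j , base≡x , eq = old₁⁻ old in ¬moved (j , base≡x , inj₁-injective eq)
  -- A new edge crosses between the halves while an old edge stays inside one, so removing `Old`
  -- never deletes a new edge.
  exchanged⇒adj₁ (H₁.replaced {j} refl) = inj₂ (new₁⁺ j) ,
    λ old → contradiction (proj₂ (proj₂ (old₁⁻ old))) λ ()

  adj₂⇒exchanged : ∀ {x y} → StitchAdj (inj₂ x) y → Exchanged₂ x y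
  adj₂⇒exchanged (inj₁ (inj₂ x~a) , ¬old) =
    H₂.kept (Adj⇒∈N X₂ x~a) λ { (j , refl , refl) → ¬old (old₂⁺ j) }
  adj₂⇒exchanged (inj₂ new , _) with new₂⁻ new
  ... | j , base≡x , refl = H₂.replaced {j = j} base≡x

  exchanged⇒adj₂ : ∀ {x y} → Exchanged₂ x y → StitchAdj (inj₂ x) y
  exchanged⇒adj₂ (H₂.kept a∈N ¬moved) = inj₁ (inj₂ (∈N⇒Adj X₂ a∈N)) ,
    λ old → let j , base≡x , eq = old₂⁻ old in ¬moved (j , base≡x , inj₂-injective eq)
  exchanged⇒adj₂ (H₂.replaced {j} refl) = inj₂ (new₂⁺ j) ,
    λ old → contradiction (proj₂ (proj₂ (old₂⁻ old))) λ ()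

  ∈N⇔exchanged₁ : ∀ x {y} → y ∈ N graph (inj₁ x) ⇔ Exchanged₁ x y
  ∈N⇔exchanged₁ x = mk⇔ (adj₁⇒exchanged ∘ ∈N⇒Adj graph) (Adj⇒∈N graph ∘ exchanged⇒adj₁)

  ∈N⇔exchanged₂ : ∀ x {y} → y ∈ N graph (inj₂ x) ⇔ Exchanged₂ x y
  ∈N⇔exchanged₂ x = mk⇔ (adj₂⇒exchanged ∘ ∈N⇒Adj graph) (Adj⇒∈N graph ∘ exchanged⇒adj₂)

  regular : Regular d X₁ → Regular d X₂ → Regular d graph
  regular reg₁ reg₂ (inj₁ x) = trans
    (H₁.exchanged-length inj₁-injective inj₂-injective (λ ()) x (N-unique graph (inj₁ x)) (∈N⇔exchanged₁ x))
    (reg₁ x)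
  regular reg₁ reg₂ (inj₂ x) = trans
    (H₂.exchanged-length inj₂-injective inj₁-injective (λ ()) x (N-unique graph (inj₂ x)) (∈N⇔exchanged₂ x))
    (reg₂ x)

  rdf : IsRDF d X₁ f₁ → IsRDF d X₂ f₂ → IsRDF d graph f
  rdf rdf₁ rdf₂ (inj₁ x) fx≡⊥ = trans
    (H₁.exchanged-⋃ inj₁-injective inj₂-injective (λ ()) x f (λ _ → refl) (λ _ → refl)
      (N-unique graph (inj₁ x)) (∈N⇔exchanged₁ x))
    (rdf₁ x fx≡⊥)
  rdf rdf₁ rdf₂ (inj₂ x) fx≡⊥ = trans
    (H₂.exchanged-⋃ inj₂-injective inj₁-injective (λ ()) x f (λ _ → refl) (λ _ → refl)
      (N-unique graph (inj₂ x)) (∈N⇔exchanged₂ x))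
    (rdf₂ x fx≡⊥)

-- Additivity of order and weight.

module _ (X₁ X₂ : Graph) (u₁ v₁ : Fin m → Vertex X₁) (u₂ v₂ : Fin m → Vertex X₂) where
  private
    open Graph X₁ using () renaming (vertices to vs₁)
    open Graph X₂ using () renaming (vertices to vs₂)
    X = stitchMany X₁ X₂ u₁ v₁ u₂ v₂

  stitch-order : order X ≡ order X₁ + order X₂
  stitch-order = trans (length-++ (map inj₁ vs₁)) (cong₂ _+_ (length-map inj₁ vs₁) (length-map inj₂ vs₂))

  stitch-weight : (f₁ : Colouring d X₁) (f₂ : Colouring d X₂) →
                  weight d X [ f₁ , f₂ ] ≡ weight d X₁ f₁ + weight d X₂ f₂
  stitch-weight {d} f₁ f₂ = begin
    sum (map w (map inj₁ vs₁ ++ map inj₂ vs₂))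
      ≡⟨ cong sum (map-++ w (map inj₁ vs₁) (map inj₂ vs₂)) ⟩
    sum (map w (map inj₁ vs₁) ++ map w (map inj₂ vs₂))
      ≡⟨ sum-++ (map w (map inj₁ vs₁)) _ ⟩
    sum (map w (map inj₁ vs₁)) + sum (map w (map inj₂ vs₂))
      ≡⟨ cong₂ (λ ks ls → sum ks + sum ls) (map-∘ vs₁) (map-∘ vs₂) ⟨
    weight _ X₁ f₁ + weight _ X₂ f₂ ∎
    where
    open ≡-Reasoning
    f : Colouring d X
    f = [ f₁ , f₂ ]
    w : Vertex X → ℕ
    w x = ∣ f x ∣

-- Stitching along arbitrary families of edge pairs.

stitchMany-RDR :
  .{{_ : NonZero d}} (X₁ X₂ : Graph) → Regular d X₁ → Regular d X₂ →
  (f₁ : Colouring d X₁) (f₂ : Colouring d X₂) →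
  IsRDRColouring d X₁ f₁ → IsRDRColouring d X₂ f₂ →
  (u₁ v₁ : Fin m → Vertex X₁) (u₂ v₂ : Fin m → Vertex X₂) →
  (∀ i → Adj X₁ (u₁ i) (v₁ i)) → (∀ i → Adj X₂ (u₂ i) (v₂ i)) →
  Injective _≡_ _≐_ (λ i → u₁ i , v₁ i) →
  Injective _≡_ _≐_ (λ i → u₂ i , v₂ i) →
  (∀ i → f₁ (u₁ i) ≡ f₂ (u₂ i)) → (∀ i → f₁ (u₁ i) ≢ ⊥) →
  IsRDR d (stitchMany X₁ X₂ u₁ v₁ u₂ v₂) ×
  IsRDRColouring d (stitchMany X₁ X₂ u₁ v₁ u₂ v₂) [ f₁ , f₂ ]
stitchMany-RDR {d} {m} X₁ X₂ reg₁ reg₂ f₁ f₂ (rdf₁ , min₁) (rdf₂ , min₂)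
               u₁ v₁ u₂ v₂ edge₁ edge₂ inj-e₁ inj-e₂ colours u₁-coloured =
  RDRColouring⇒RDR X (Stitched.regular reg₁ reg₂) colouring , colouring
  where
  X = stitchMany X₁ X₂ u₁ v₁ u₂ v₂
  module M₁ = RegularRDF.Minimum X₁ reg₁ rdf₁ min₁
  module M₂ = RegularRDF.Minimum X₂ reg₂ rdf₂ min₂

  u₂-coloured : ∀ i → f₂ (u₂ i) ≢ ⊥
  u₂-coloured i = u₁-coloured i ∘ trans (colours i)

  v₁-blank : ∀ i → f₁ (v₁ i) ≡ ⊥
  v₁-blank i = M₁.coloured⇒neighbour-uncoloured (u₁-coloured i) (edge₁ i)

  v₂-blank : ∀ i → f₂ (v₂ i) ≡ ⊥
  v₂-blank i = M₂.coloured⇒neighbour-uncoloured (u₂-coloured i) (edge₂ i)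

  -- The vertices `u₂ i` and `u₂ j` are neighbours of the same uncoloured vertex and share the
  -- colour of the common `u₁`, hence coincide. The second edges with indices `i` and `j` are then
  -- equal, and `inj-e₂` applies.
  u₁-v₂ : ∀ {i j} → u₁ i ≡ u₁ j → v₂ i ≡ v₂ j → i ≡ j
  u₁-v₂ {i} {j} u₁≡ v₂≡ = inj-e₂ (inj₁ (cong₂ _,_ u₂≡ v₂≡))
    where
    u₂≡ : u₂ i ≡ u₂ j
    u₂≡ = M₂.uncoloured⇒same-colour⇒≡ (v₂-blank i) (u₂-coloured i) (Graph.adj-sym X₂ (edge₂ i))
      (subst (λ v → Adj X₂ v (u₂ j)) (sym v₂≡) (Graph.adj-sym X₂ (edge₂ j)))
      (trans (sym (colours i)) (trans (cong f₁ u₁≡) (colours j)))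

  -- The mirror argument around the uncoloured `v₁ i`, with the colour transported from the common
  -- `u₂`.
  v₁-u₂ : ∀ {i j} → v₁ i ≡ v₁ j → u₂ i ≡ u₂ j → i ≡ j
  v₁-u₂ {i} {j} v₁≡ u₂≡ = inj-e₁ (inj₁ (cong₂ _,_ u₁≡ v₁≡))
    where
    u₁≡ : u₁ i ≡ u₁ j
    u₁≡ = M₁.uncoloured⇒same-colour⇒≡ (v₁-blank i) (u₁-coloured i) (Graph.adj-sym X₁ (edge₁ i))
      (subst (λ v → Adj X₁ v (u₁ j)) (sym v₁≡) (Graph.adj-sym X₁ (edge₁ j)))
      (trans (colours i) (trans (cong f₂ u₂≡) (sym (colours j))))

  S₁ : StitchingData d {X₁} {X₂} f₁ f₂ u₁ v₁ u₂ v₂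
  S₁ = record
    { edge = edge₁ ; u-coloured = u₁-coloured ; v-blank = v₁-blank ; v′-blank = v₂-blank
    ; colours = colours ; injective = inj-e₁ ; u-v′ = u₁-v₂ ; v-u′ = v₁-u₂ }

  S₂ : StitchingData d {X₂} {X₁} f₂ f₁ u₂ v₂ u₁ v₁
  S₂ = record
    { edge = edge₂ ; u-coloured = u₂-coloured ; v-blank = v₂-blank ; v′-blank = v₁-blank
    ; colours = λ i → sym (colours i) ; injective = inj-e₂
    -- Seen from the other half the two crossing conditions trade places, with their premises in
    -- reverse order.
    ; u-v′ = λ p q → v₁-u₂ q p ; v-u′ = λ p q → u₁-v₂ q p }

  module Stitched = StitchRDR S₁ S₂

  colouring : IsRDRColouring d X [ f₁ , f₂ ]
  colouring = Stitched.rdf rdf₁ rdf₂ , (begin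
    2 * weight d X [ f₁ , f₂ ]                 ≡⟨ cong (2 *_) (stitch-weight X₁ X₂ u₁ v₁ u₂ v₂ f₁ f₂) ⟩
    2 * (weight d X₁ f₁ + weight d X₂ f₂)      ≡⟨ *-distribˡ-+ 2 (weight d X₁ f₁) _ ⟩
    2 * weight d X₁ f₁ + 2 * weight d X₂ f₂    ≡⟨ cong₂ _+_ min₁ min₂ ⟩
    order X₁ + order X₂                        ≡⟨ stitch-order X₁ X₂ u₁ v₁ u₂ v₂ ⟨
    order X                                    ∎)
    where open ≡-Reasoning

proposition2p6 : (d : ℕ) .{{_ : NonZero d}} (X₁ X₂ : Graph) →
    IsRDR d X₁ → IsRDR d X₂ →
    (f₁ : Colouring d X₁) (f₂ : Colouring d X₂) →
    IsRDRColouring d X₁ f₁ → IsRDRColouring d X₂ f₂ →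
    ( (u₁ v₁ : Vertex X₁) (u₂ v₂ : Vertex X₂) →
    Adj X₁ u₁ v₁ → Adj X₂ u₂ v₂ →
    f₁ u₁ ≡ f₂ u₂ → f₁ u₁ ≢ ⊥ →
    (f₁ v₁ ≡ ⊥ × f₂ v₂ ≡ ⊥) ×
    IsRDR d (stitch X₁ X₂ u₁ v₁ u₂ v₂) ×
    IsRDRColouring d (stitch X₁ X₂ u₁ v₁ u₂ v₂) [ f₁ , f₂ ] ) ×
    ( (m : ℕ) (u₁ v₁ : Fin m → Vertex X₁) (u₂ v₂ : Fin m → Vertex X₂) →
    (∀ i → Adj X₁ (u₁ i) (v₁ i)) → (∀ i → Adj X₂ (u₂ i) (v₂ i)) →
    Injective _≡_ _≐_ (λ i → u₁ i , v₁ i) →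
    Injective _≡_ _≐_ (λ i → u₂ i , v₂ i) →
    (∀ i → f₁ (u₁ i) ≡ f₂ (u₂ i)) → (∀ i → f₁ (u₁ i) ≢ ⊥) →
    IsRDR d (stitchMany X₁ X₂ u₁ v₁ u₂ v₂) ×
    IsRDRColouring d (stitchMany X₁ X₂ u₁ v₁ u₂ v₂) [ f₁ , f₂ ] )
proposition2p6 d X₁ X₂ (reg₁ , _) (reg₂ , _) f₁ f₂ c₁@(rdf₁ , min₁) c₂@(rdf₂ , min₂) =
  (λ u₁ v₁ u₂ v₂ u₁~v₁ u₂~v₂ fu₁≡fu₂ fu₁≢⊥ →
    ( RegularRDF.Minimum.coloured⇒neighbour-uncoloured X₁ reg₁ rdf₁ min₁ fu₁≢⊥ u₁~v₁
    , RegularRDF.Minimum.coloured⇒neighbour-uncoloured X₂ reg₂ rdf₂ min₂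
        (fu₁≢⊥ ∘ trans fu₁≡fu₂) u₂~v₂) ,
    stitchMany-RDR X₁ X₂ reg₁ reg₂ f₁ f₂ c₁ c₂ _ _ _ _
      (λ _ → u₁~v₁) (λ _ → u₂~v₂) singleton singleton (λ _ → fu₁≡fu₂) (λ _ → fu₁≢⊥)) ,
  λ m → stitchMany-RDR X₁ X₂ reg₁ reg₂ f₁ f₂ c₁ c₂
  where
  -- A single stitch is the family indexed by `Fin 1`, for which distinctness of the edges is
  -- automatic.
  singleton : {P : Set} {i j : Fin 1} → P → i ≡ j
  singleton {i = zero} {zero} _ = refl
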